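{- For every dimension $d$, the minimum number $f(d)$ of boxes in a double cover of $\{0,1,2\}^d$ satisfies $$f(d)\ \ge\ \frac{2^{d+1}}{d+1}.$$
   Context: Write $[3]=\{0,1,2\}$. A proper sub-box of $[3]^d$ is a set $B=S_1\times\dots\times S_d$ with $\varnothing\neq S_i\subsetneq[3]$ for every $1\le i\le d$ (so each side $S_i$ has one or two elements). A double cover of $[3]^d$ is a finite multiset $\{B_1,\dots,B_m\}$ of proper sub-boxes such that every point of $[3]^d$ lies in exactly two of the $B_j$, counted with multiplicity; its size is $m$. $f(d)$ denotes the minimum size of a double cover of $[3]^d$. -}

module Defs where

open import Data.Bool.Base using (true; false)
open import Data.Fin.Base using (Fin; zero; suc)
open import Data.Fin.Properties as Fin using ()
open import Data.Fin.Subset using (Subset; inside; outside; Nonempty; _∈_; _⊂_; ⊤)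
open import Data.Fin.Subset.Properties using (_∈?_; _⊂?_; nonempty?; anySubset?)
open import Data.Nat.Base using (ℕ; zero; suc; _+_; _≤_; z≤n; s≤s)
open import Data.Nat.Properties using (_≟_)
open import Data.Product.Base using (Σ; ∃; _×_; _,_; proj₁; proj₂)
open import Data.Vec.Base using (Vec; []; _∷_; _++_; map; count)
open import Data.Vec.Relation.Binary.Pointwise.Inductive as Pointwise
  using (Pointwise; []; _∷_)
open import Data.Vec.Relation.Unary.All as All using (All; []; _∷_)
open import Data.Vec.Relation.Unary.All.Properties using (map⁺; ++⁺)
open import Relation.Binary.PropositionalEquality
  using (_≡_; refl; cong; cong₂; trans)
open import Relation.Nullary using (Dec; yes; no; does; contradiction)
open import Relation.Nullary.Decidable using (map′; _×-dec_; from-yes)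
open import Relation.Unary using (Pred; Decidable)
open import Level using (0ℓ)

Point : ℕ → Set
Point d = Vec (Fin 3) d

-- A box is represented by its sides.  Distinct vectors of sides may denote the
-- same set of points only when some side is empty, so this representation is
-- faithful on proper boxes.
Box : ℕ → Set
Box d = Vec (Subset 3) d

ProperSide : Subset 3 → Set
ProperSide S = Nonempty S × S ⊂ ⊤

Proper : ∀ {d} → Box d → Set
Proper = All ProperSide

infix 4 _∈ᴮ_ _∈ᴮ?_

_∈ᴮ_ : ∀ {d} → Point d → Box d → Set
_∈ᴮ_ = Pointwise _∈_

_∈ᴮ?_ : ∀ {d} (x : Point d) (B : Box d) → Dec (x ∈ᴮ B)
_∈ᴮ?_ = Pointwise.decidable _∈?_

multiplicity : ∀ {d m} → Point d → Vec (Box d) m → ℕ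
multiplicity x = count (x ∈ᴮ?_)

-- A multiset of m boxes is given by a listing B₁, …, Bₘ, repetitions allowed;
-- the definition does not depend on the order of the listing.
DoubleCover : ∀ {d m} → Vec (Box d) m → Set
DoubleCover {d} Bs = All Proper Bs × (∀ (x : Point d) → multiplicity x Bs ≡ 2)

HasDoubleCover : ℕ → ℕ → Set
HasDoubleCover d m = Σ (Vec (Box d) m) DoubleCover

IsMinimum : Pred ℕ 0ℓ → Pred ℕ 0ℓ
IsMinimum P m = P m × (∀ n → P n → m ≤ n)

-- The rest of the module shows that the minimum size of a double cover exists,
-- by finite search below the size of an explicit double cover.

private

  anyVec? : ∀ {A : Set} → (∀ {P : Pred A 0ℓ} → Decidable P → Dec (∃ P)) →
            ∀ n {P : Pred (Vec A n) 0ℓ} → Decidable P → Dec (∃ P)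
  anyVec? any zero    P? = map′ ([] ,_) (λ { ([] , p) → p }) (P? [])
  anyVec? any (suc n) P? =
    map′ (λ { (x , xs , p) → x ∷ xs , p }) (λ { (x ∷ xs , p) → x , xs , p })
         (any λ x → anyVec? any n λ xs → P? (x ∷ xs))

  allPoints? : ∀ d {P : Pred (Point d) 0ℓ} → Decidable P → Dec (∀ x → P x)
  allPoints? zero    P? = map′ (λ { p [] → p }) (λ p → p []) (P? [])
  allPoints? (suc d) P? =
    map′ (λ { p (x ∷ xs) → p x xs }) (λ p x xs → p (x ∷ xs))
         (Fin.all? λ x → allPoints? d λ xs → P? (x ∷ xs))

properSide? : Decidable ProperSide
properSide? S = nonempty? S ×-dec (S ⊂? ⊤)

doubleCover? : ∀ {d m} → Decidable (DoubleCover {d} {m})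
doubleCover? {d} Bs =
  All.all? (All.all? properSide?) Bs ×-dec allPoints? d (λ x → multiplicity x Bs ≟ 2)

hasDoubleCover? : ∀ d → Decidable (HasDoubleCover d)
hasDoubleCover? d m = anyVec? (anyVec? anySubset? d) m doubleCover?

private

  ⁅01⁆ ⁅2⁆ : Subset 3
  ⁅01⁆ = inside ∷ inside ∷ outside ∷ []
  ⁅2⁆  = outside ∷ outside ∷ inside ∷ []

  size : ℕ → ℕ
  size zero    = 2
  size (suc d) = size d + size d

  cover : ∀ d → Vec (Box d) (size d)
  cover zero    = [] ∷ [] ∷ []
  cover (suc d) = map (⁅01⁆ ∷_) (cover d) ++ map (⁅2⁆ ∷_) (cover d)

  multiplicity-++ : ∀ {d m n} (x : Point d) (Bs : Vec (Box d) m) (Cs : Vec (Box d) n) →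
                    multiplicity x (Bs ++ Cs) ≡ multiplicity x Bs + multiplicity x Cs
  multiplicity-++ x []       Cs = refl
  multiplicity-++ x (B ∷ Bs) Cs with does (x ∈ᴮ? B)
  ... | true  = cong suc (multiplicity-++ x Bs Cs)
  ... | false = multiplicity-++ x Bs Cs

  multiplicity-in : ∀ {d m} i (x : Point d) S (Bs : Vec (Box d) m) → does (i ∈? S) ≡ true →
                    multiplicity (i ∷ x) (map (S ∷_) Bs) ≡ multiplicity x Bs
  multiplicity-in i x S []       i∈S = refl
  multiplicity-in i x S (B ∷ Bs) i∈S rewrite i∈S with does (x ∈ᴮ? B)
  ... | true  = cong suc (multiplicity-in i x S Bs i∈S)
  ... | false = multiplicity-in i x S Bs i∈S

  multiplicity-out : ∀ {d m} i (x : Point d) S (Bs : Vec (Box d) m) → does (i ∈? S) ≡ false →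
                     multiplicity (i ∷ x) (map (S ∷_) Bs) ≡ 0
  multiplicity-out i x S []       i∉S = refl
  multiplicity-out i x S (B ∷ Bs) i∉S rewrite i∉S = multiplicity-out i x S Bs i∉S

  cover-multiplicity : ∀ d (x : Point d) → multiplicity x (cover d) ≡ 2
  cover-multiplicity zero    []      = refl
  cover-multiplicity (suc d) (i ∷ x) =
    trans (multiplicity-++ (i ∷ x) (map (⁅01⁆ ∷_) (cover d)) (map (⁅2⁆ ∷_) (cover d))) (slices i)
    where
    Bs = cover d

    slices : ∀ i → multiplicity (i ∷ x) (map (⁅01⁆ ∷_) Bs) +
                   multiplicity (i ∷ x) (map (⁅2⁆ ∷_) Bs) ≡ 2
    slices zero =
      cong₂ _+_ (trans (multiplicity-in zero x ⁅01⁆ Bs refl) (cover-multiplicity d x))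
                (multiplicity-out zero x ⁅2⁆ Bs refl)
    slices (suc zero) =
      cong₂ _+_ (trans (multiplicity-in (suc zero) x ⁅01⁆ Bs refl) (cover-multiplicity d x))
                (multiplicity-out (suc zero) x ⁅2⁆ Bs refl)
    slices (suc (suc zero)) =
      cong₂ _+_ (multiplicity-out (suc (suc zero)) x ⁅01⁆ Bs refl)
                (trans (multiplicity-in (suc (suc zero)) x ⁅2⁆ Bs refl) (cover-multiplicity d x))

  cover-proper : ∀ d → All Proper (cover d)
  cover-proper zero    = [] ∷ [] ∷ []
  cover-proper (suc d) =
    ++⁺ (map⁺ (All.map (from-yes (properSide? ⁅01⁆) ∷_) (cover-proper d)))
        (map⁺ (All.map (from-yes (properSide? ⁅2⁆) ∷_) (cover-proper d)))

  search : ∀ {P : Pred ℕ 0ℓ} → Decidable P → ∀ n → P n → ∃ (IsMinimum P)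
  search P? zero    p = zero , p , λ _ _ → z≤n
  search P? (suc n) p with P? zero
  ... | yes p₀ = zero , p₀ , λ _ _ → z≤n
  ... | no ¬p₀ with search (λ m → P? (suc m)) n p
  ...   | m , q , least = suc m , q , λ where
            zero    p₀ → contradiction p₀ ¬p₀
            (suc k) pₖ → s≤s (least k pₖ)

minimum : ∀ d → ∃ (IsMinimum (HasDoubleCover d))
minimum d = search (hasDoubleCover? d) (size d) (cover d , cover-proper d , cover-multiplicity d)

f : ℕ → ℕ
f d = proj₁ (minimum d)

f-isMinimum : ∀ d → IsMinimum (HasDoubleCover d) (f d)
f-isMinimum d = proj₂ (minimum d)

{-# OPTIONS --safe #-}
-- Call a product R = R₁ × … × R_d a test set if every Rᵢ is a singleton or all
-- of [3].  Then |R| is odd, so a double cover satisfies Σⱼ |Bⱼ ∩ R| = 2|R| ≡ 2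
-- (mod 4).  The distance to 4ℤ is subadditive, so the distances of the numbers
-- |Bⱼ ∩ R| sum to at least 2 for each of the 4ᵈ test sets R.  On the other hand,
-- for a fixed proper box B the distance of |B ∩ R| is 1 if all factors |Sᵢ ∩ Rᵢ|
-- are odd, is 2 if exactly one factor is 2 and the others are odd, and is 0
-- otherwise; summed over all R this is at most (d + 1) 2ᵈ.
module Submission where

open import Defs
open import Data.Bool.Base using (Bool; true; false; if_then_else_)
open import Data.Fin.Base using (Fin)
open import Data.Fin.Patterns using (0F; 1F; 2F)
open import Data.Fin.Subset.Properties using (_∈?_; ∈⊤)
open import Data.Integer.Base as ℤ using (+_)
import Data.Integer.Properties as ℤ
open import Data.Maybe.Base using (Maybe; just; nothing)
open import Data.Nat.Base using (ℕ; zero; suc; _+_; _*_; _^_; _≤_; z≤n; s≤s)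
open import Data.Nat.Properties
open import Data.Nat.Tactic.RingSolver using (solve-∀)
open import Data.Product.Base using (∃; _,_; proj₁)
open import Data.Rational.Base using (_/_; _≥_)
import Data.Rational.Properties as ℚ
open import Data.Rational.Unnormalised.Base using (mkℚᵘ; *≤*)
import Data.Rational.Unnormalised.Properties as ℚᵘ
open import Data.Vec.Base using (Vec; []; _∷_; there)
open import Data.Vec.Relation.Unary.All using (All; []; _∷_)
open import Relation.Binary.PropositionalEquality
open import Relation.Nullary using (does; contradiction)

dist₄ : ℕ → ℕ
dist₄ 0 = 0
dist₄ 1 = 1
dist₄ 2 = 2
dist₄ 3 = 1
dist₄ (suc (suc (suc (suc n)))) = dist₄ n

dist₄-periodic : ∀ k n → dist₄ (k * 4 + n) ≡ dist₄ n
dist₄-periodic zero    n = refl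
dist₄-periodic (suc k) n = dist₄-periodic k n

dist₄-quadruple : ∀ n → dist₄ (n + n + (n + n)) ≡ 0
dist₄-quadruple n = trans (cong dist₄ (eq n)) (dist₄-periodic n 0)
  where
  eq : ∀ n → n + n + (n + n) ≡ n * 4 + 0
  eq = solve-∀

-- Only residues modulo 4 matter: the clauses with four `suc`s reduce definitionally to smaller
-- arguments, leaving a finite table.
dist₄-sub : ∀ m n → dist₄ (m + n) ≤ dist₄ m + dist₄ n
dist₄-sub (suc (suc (suc (suc m)))) n = dist₄-sub m n
dist₄-sub 0 n = ≤-refl
dist₄-sub 1 0 = ≤-refl
dist₄-sub 1 1 = ≤-refl
dist₄-sub 1 2 = s≤s z≤n
dist₄-sub 1 3 = z≤n
dist₄-sub 1 (suc (suc (suc (suc n)))) = dist₄-sub 1 n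
dist₄-sub 2 0 = ≤-refl
dist₄-sub 2 1 = s≤s z≤n
dist₄-sub 2 2 = z≤n
dist₄-sub 2 3 = s≤s z≤n
dist₄-sub 2 (suc (suc (suc (suc n)))) = dist₄-sub 2 n
dist₄-sub 3 0 = ≤-refl
dist₄-sub 3 1 = z≤n
dist₄-sub 3 2 = s≤s z≤n
dist₄-sub 3 3 = ≤-refl
dist₄-sub 3 (suc (suc (suc (suc n)))) = dist₄-sub 3 n

-- A side just i stands for {i}, and nothing for the whole of [3].
TestSet : ℕ → Set
TestSet = Vec (Maybe (Fin 3))

sumOver : ∀ {d} → TestSet d → (Point d → ℕ) → ℕ
sumOver []            g = g []
sumOver (just i ∷ R)  g = sumOver R λ x → g (i ∷ x)
sumOver (nothing ∷ R) g =
  sumOver R (λ x → g (0F ∷ x)) + sumOver R (λ x → g (1F ∷ x)) + sumOver R (λ x → g (2F ∷ x))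

sumOver-cong : ∀ {d} (R : TestSet d) {g h : Point d → ℕ} →
               (∀ x → g x ≡ h x) → sumOver R g ≡ sumOver R h
sumOver-cong []            g≡h = g≡h []
sumOver-cong (just i ∷ R)  g≡h = sumOver-cong R λ x → g≡h (i ∷ x)
sumOver-cong (nothing ∷ R) g≡h =
  cong₂ _+_ (cong₂ _+_ (sumOver-cong R λ x → g≡h (0F ∷ x)) (sumOver-cong R λ x → g≡h (1F ∷ x)))
            (sumOver-cong R λ x → g≡h (2F ∷ x))

sumOver-+ : ∀ {d} (R : TestSet d) (g h : Point d → ℕ) →
            sumOver R (λ x → g x + h x) ≡ sumOver R g + sumOver R h
sumOver-+ []            g h = refl
sumOver-+ (just i ∷ R)  g h = sumOver-+ R (λ x → g (i ∷ x)) (λ x → h (i ∷ x))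
sumOver-+ (nothing ∷ R) g h =
  trans (cong₂ _+_ (cong₂ _+_ (slice 0F) (slice 1F)) (slice 2F))
        (regroup (part g 0F) (part g 1F) (part g 2F) (part h 0F) (part h 1F) (part h 2F))
  where
  part : (Point _ → ℕ) → Fin 3 → ℕ
  part k i = sumOver R λ x → k (i ∷ x)

  slice : ∀ i → part (λ x → g x + h x) i ≡ part g i + part h i
  slice i = sumOver-+ R (λ x → g (i ∷ x)) (λ x → h (i ∷ x))

  regroup : ∀ a b c a′ b′ c′ → a + a′ + (b + b′) + (c + c′) ≡ a + b + c + (a′ + b′ + c′)
  regroup = solve-∀

sumOver-0 : ∀ {d} (R : TestSet d) → sumOver R (λ _ → 0) ≡ 0
sumOver-0 []            = refl
sumOver-0 (just i ∷ R)  = sumOver-0 R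
sumOver-0 (nothing ∷ R) rewrite sumOver-0 R = refl

-- This is the oddness of |R|, in the form used later. A whole side triples the sum, and 3(4k + 2) =
-- 4(1 + 3k) + 2 keeps the residue.
sumOver-2 : ∀ {d} (R : TestSet d) → ∃ λ k → sumOver R (λ _ → 2) ≡ k * 4 + 2
sumOver-2 []            = 0 , refl
sumOver-2 (just i ∷ R)  = sumOver-2 R
sumOver-2 (nothing ∷ R) with sumOver-2 R
... | k , eq rewrite eq = 1 + k * 3 , triple k
  where
  triple : ∀ k → k * 4 + 2 + (k * 4 + 2) + (k * 4 + 2) ≡ (1 + k * 3) * 4 + 2
  triple = solve-∀

indicator : ∀ {d} → Box d → Point d → ℕ
indicator B x = if does (x ∈ᴮ? B) then 1 else 0

multiplicity-∷ : ∀ {d m} (x : Point d) (B : Box d) (Bs : Vec (Box d) m) →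
                 multiplicity x (B ∷ Bs) ≡ indicator B x + multiplicity x Bs
multiplicity-∷ x B Bs with does (x ∈ᴮ? B)
... | true  = refl
... | false = refl

∣_∩_∣ : ∀ {d} → Box d → TestSet d → ℕ
∣ B ∩ R ∣ = sumOver R (indicator B)

only : Bool → ℕ → ℕ
only b n = if b then n else 0

-- Fixing the head leaves either a full copy of `B ∩ R` or nothing. This brings the counts for all
-- four heads of a test set into the shape of `side-bound`.
sumOver-slice : ∀ {d} (R : TestSet d) (B : Box d) S i →
                sumOver R (λ x → indicator (S ∷ B) (i ∷ x)) ≡ only (does (i ∈? S)) ∣ B ∩ R ∣
sumOver-slice R B S i with does (i ∈? S)
... | true  = refl
... | false = sumOver-0 R

∑ : ∀ {d} → (TestSet d → ℕ) → ℕ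
∑ {zero}  h = h []
-- The head is summed innermost, so that an estimate of the four heads over a common tail can be
-- applied under `∑`.
∑ {suc d} h = ∑ λ R → h (just 0F ∷ R) + h (just 1F ∷ R) + h (just 2F ∷ R) + h (nothing ∷ R)

∑-mono : ∀ {d} {g h : TestSet d → ℕ} → (∀ R → g R ≤ h R) → ∑ g ≤ ∑ h
∑-mono {zero}  g≤h = g≤h []
∑-mono {suc d} g≤h = ∑-mono λ R →
  +-mono-≤ (+-mono-≤ (+-mono-≤ (g≤h (just 0F ∷ R)) (g≤h (just 1F ∷ R))) (g≤h (just 2F ∷ R)))
           (g≤h (nothing ∷ R))

∑-cong : ∀ {d} {g h : TestSet d → ℕ} → (∀ R → g R ≡ h R) → ∑ g ≡ ∑ h
∑-cong g≡h = ≤-antisym (∑-mono λ R → ≤-reflexive (g≡h R))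
                       (∑-mono λ R → ≤-reflexive (sym (g≡h R)))

∑-+ : ∀ {d} (g h : TestSet d → ℕ) → ∑ (λ R → g R + h R) ≡ ∑ g + ∑ h
∑-+ {zero}  g h = refl
∑-+ {suc d} g h = trans
  (∑-cong {d} λ R → regroup (g (just 0F ∷ R)) (g (just 1F ∷ R)) (g (just 2F ∷ R)) (g (nothing ∷ R))
                        (h (just 0F ∷ R)) (h (just 1F ∷ R)) (h (just 2F ∷ R)) (h (nothing ∷ R)))
  (∑-+ (total g) (total h))
  where
  total : (TestSet (suc d) → ℕ) → TestSet d → ℕ
  total k R = k (just 0F ∷ R) + k (just 1F ∷ R) + k (just 2F ∷ R) + k (nothing ∷ R)

  regroup : ∀ p q r s p′ q′ r′ s′ → p + p′ + (q + q′) + (r + r′) + (s + s′) ≡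
                                    p + q + r + s + (p′ + q′ + r′ + s′)
  regroup = solve-∀

-- The number 4ᵈ of test sets is kept as a product because one factor `2 ^ d` cancels at the end.
∑-const : ∀ d c → ∑ {d} (λ _ → c) ≡ (2 ^ d * 2 ^ d) * c
∑-const zero    c = sym (*-identityˡ c)
∑-const (suc d) c = trans (∑-const d (c + c + c + c)) (quadruple (2 ^ d) c)
  where
  quadruple : ∀ p c → (p * p) * (c + c + c + c) ≡ (2 * p * (2 * p)) * c
  quadruple = solve-∀

∑-0 : ∀ {d} → ∑ {d} (λ _ → 0) ≡ 0
∑-0 {d} = trans (∑-const d 0) (*-zeroʳ (2 ^ d * 2 ^ d))

-- If |S| = 2, two singleton heads give `φ n`, the third `φ 0`, and the whole side `φ (n + n)`:
-- equality. If |S| = 1, the left side is only `φ n + φ n`. The function stays general because both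
-- `dist₄` and its composite with doubling are needed.
side-bound : ∀ (φ : ℕ → ℕ) → φ 0 ≡ 0 → ∀ {S} → ProperSide S → ∀ n →
             let s = λ i → only (does (i ∈? S)) n in
             φ (s 0F) + φ (s 1F) + φ (s 2F) + φ (s 0F + s 1F + s 2F) ≤ φ n + φ n + φ (n + n)
side-bound φ φ0 {false ∷ false ∷ false ∷ []} ((_ , there (there (there ()))) , _) n
-- This side is `⊤` itself, which cannot miss the point that strict inclusion provides.
side-bound φ φ0 {true ∷ true ∷ true ∷ []} (_ , _ , _ , _ , i∉S) n = contradiction ∈⊤ i∉S
side-bound φ φ0 {true ∷ false ∷ false ∷ []} _ n
  rewrite φ0 | +-identityʳ n | +-identityʳ n | +-identityʳ (φ n) | +-identityʳ (φ n) = m≤m+n _ _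
side-bound φ φ0 {false ∷ true ∷ false ∷ []} _ n
  rewrite φ0 | +-identityʳ n | +-identityʳ (φ n) = m≤m+n _ _
side-bound φ φ0 {false ∷ false ∷ true ∷ []} _ n
  rewrite φ0 = m≤m+n _ _
side-bound φ φ0 {true ∷ true ∷ false ∷ []} _ n
  rewrite φ0 | +-identityʳ (n + n) | +-identityʳ (φ n + φ n) = ≤-refl
side-bound φ φ0 {true ∷ false ∷ true ∷ []} _ n
  rewrite φ0 | +-identityʳ n | +-identityʳ (φ n) = ≤-refl
side-bound φ φ0 {false ∷ true ∷ true ∷ []} _ n
  rewrite φ0 = ≤-refl

∑-box : ∀ {d} (φ : ℕ → ℕ) → φ 0 ≡ 0 → ∀ {S} → ProperSide S → ∀ (B : Box d) →
        ∑ (λ R → φ ∣ S ∷ B ∩ R ∣) ≤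
        ∑ (λ R → φ ∣ B ∩ R ∣) + ∑ (λ R → φ ∣ B ∩ R ∣) + ∑ (λ R → φ (∣ B ∩ R ∣ + ∣ B ∩ R ∣))
∑-box φ φ0 {S} S-proper B = begin
  ∑ (λ R → φ ∣ S ∷ B ∩ R ∣)            ≤⟨ ∑-mono pointwise ⟩
  ∑ (λ R → once R + once R + twice R)  ≡⟨ ∑-+ (λ R → once R + once R) twice ⟩
  ∑ (λ R → once R + once R) + ∑ twice  ≡⟨ cong (_+ ∑ twice) (∑-+ once once) ⟩
  ∑ once + ∑ once + ∑ twice            ∎
  where
  open ≤-Reasoning
  once twice : TestSet _ → ℕ
  once  R = φ ∣ B ∩ R ∣
  twice R = φ (∣ B ∩ R ∣ + ∣ B ∩ R ∣)

  pointwise : ∀ R → φ ∣ S ∷ B ∩ just 0F ∷ R ∣ + φ ∣ S ∷ B ∩ just 1F ∷ R ∣ +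
                    φ ∣ S ∷ B ∩ just 2F ∷ R ∣ + φ ∣ S ∷ B ∩ nothing ∷ R ∣ ≤
                    once R + once R + twice R
  pointwise R
    rewrite sumOver-slice R B S 0F | sumOver-slice R B S 1F | sumOver-slice R B S 2F
    = side-bound φ φ0 S-proper ∣ B ∩ R ∣

-- The doubling stands for a factor 2 already contributed by another side. A second factor 2 gives a
-- multiple of 4, so each new side at most doubles the sum, starting from `dist₄ 2` in dimension 0.
∑-dist₄-double : ∀ {d} {B : Box d} → Proper B →
                 ∑ (λ R → dist₄ (∣ B ∩ R ∣ + ∣ B ∩ R ∣)) ≤ 2 * 2 ^ d
∑-dist₄-double                 []                     = ≤-refl
∑-dist₄-double {suc d} {S ∷ B} (S-proper ∷ B-proper) = begin
  ∑ (λ R → double ∣ S ∷ B ∩ R ∣)                    ≤⟨ ∑-box double refl S-proper B ⟩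
  K + K + ∑ (λ R → double (∣ B ∩ R ∣ + ∣ B ∩ R ∣))   ≤⟨ +-monoʳ-≤ (K + K) (≤-reflexive vanish) ⟩
  K + K + 0                                         ≤⟨ +-monoˡ-≤ 0 (+-mono-≤ ih ih) ⟩
  2 * 2 ^ d + 2 * 2 ^ d + 0                         ≡⟨ arith (2 ^ d) ⟩
  2 * 2 ^ suc d                                     ∎
  where
  open ≤-Reasoning
  double : ℕ → ℕ
  double n = dist₄ (n + n)

  K = ∑ λ R → double ∣ B ∩ R ∣
  ih = ∑-dist₄-double B-proper

  vanish : ∑ (λ R → double (∣ B ∩ R ∣ + ∣ B ∩ R ∣)) ≡ 0
  vanish = trans (∑-cong λ R → dist₄-quadruple ∣ B ∩ R ∣) (∑-0 {d})

  arith : ∀ p → 2 * p + 2 * p + 0 ≡ 2 * (2 * p)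
  arith = solve-∀

-- The bounds obey a(0) = 1 and a(d + 1) = 2a(d) + 2 · 2ᵈ, solved by (d + 1)2ᵈ. The added term
-- covers test sets on which the new side supplies the factor 2.
∑-dist₄ : ∀ {d} {B : Box d} → Proper B → ∑ (λ R → dist₄ ∣ B ∩ R ∣) ≤ suc d * 2 ^ d
∑-dist₄                 []                     = ≤-refl
∑-dist₄ {suc d} {S ∷ B} (S-proper ∷ B-proper) = begin
  ∑ (λ R → dist₄ ∣ S ∷ B ∩ R ∣)                     ≤⟨ ∑-box dist₄ refl S-proper B ⟩
  K + K + ∑ (λ R → dist₄ (∣ B ∩ R ∣ + ∣ B ∩ R ∣))    ≤⟨ +-mono-≤ (+-mono-≤ ih ih) (∑-dist₄-double B-proper) ⟩
  suc d * 2 ^ d + suc d * 2 ^ d + 2 * 2 ^ d         ≡⟨ arith d (2 ^ d) ⟩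
  suc (suc d) * 2 ^ suc d                           ∎
  where
  open ≤-Reasoning
  K = ∑ λ R → dist₄ ∣ B ∩ R ∣
  ih = ∑-dist₄ B-proper

  arith : ∀ d p → suc d * p + suc d * p + 2 * p ≡ suc (suc d) * (2 * p)
  arith = solve-∀

-- Summing multiplicities over R gives Σⱼ |Bⱼ ∩ R|, from which subadditivity splits off one box at a
-- time.
∑-dist₄-multiplicity : ∀ {d m} {Bs : Vec (Box d) m} → All Proper Bs →
                       ∑ (λ R → dist₄ (sumOver R λ x → multiplicity x Bs)) ≤ m * (suc d * 2 ^ d)
∑-dist₄-multiplicity {d} [] =
  ≤-reflexive (trans (∑-cong {d} λ R → cong dist₄ (sumOver-0 R)) (∑-0 {d}))
∑-dist₄-multiplicity {d} {suc m} {B ∷ Bs} (B-proper ∷ Bs-proper) = begin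
  ∑ (λ R → dist₄ (sumOver R λ x → multiplicity x (B ∷ Bs)))      ≤⟨ ∑-mono split ⟩
  ∑ (λ R → dist₄ ∣ B ∩ R ∣ + dist₄ (total R))                    ≡⟨ ∑-+ (λ R → dist₄ ∣ B ∩ R ∣) _ ⟩
  ∑ (λ R → dist₄ ∣ B ∩ R ∣) + ∑ (λ R → dist₄ (total R))          ≤⟨ +-mono-≤ (∑-dist₄ B-proper) (∑-dist₄-multiplicity Bs-proper) ⟩
  suc d * 2 ^ d + m * (suc d * 2 ^ d)                            ∎
  where
  open ≤-Reasoning
  total : TestSet d → ℕ
  total R = sumOver R λ x → multiplicity x Bs

  split : ∀ R → dist₄ (sumOver R λ x → multiplicity x (B ∷ Bs)) ≤ dist₄ ∣ B ∩ R ∣ + dist₄ (total R)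
  split R = begin
    dist₄ (sumOver R λ x → multiplicity x (B ∷ Bs))
      ≡⟨ cong dist₄ (sumOver-cong R λ x → multiplicity-∷ x B Bs) ⟩
    dist₄ (sumOver R λ x → indicator B x + multiplicity x Bs)
      ≡⟨ cong dist₄ (sumOver-+ R (indicator B) _) ⟩
    dist₄ (∣ B ∩ R ∣ + total R)
      ≤⟨ dist₄-sub ∣ B ∩ R ∣ (total R) ⟩
    dist₄ ∣ B ∩ R ∣ + dist₄ (total R) ∎

doubleCover-size : ∀ {d m} → HasDoubleCover d m → 2 ^ suc d ≤ m * suc d
-- The two estimates of the same sum give 2 · 4ᵈ ≤ m(d + 1)2ᵈ, from which 2ᵈ is cancelled.
doubleCover-size {d} {m} (Bs , Bs-proper , covers) = *-cancelʳ-≤ (2 ^ suc d) (m * suc d) (2 ^ d) (begin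
  2 ^ suc d * 2 ^ d                                       ≡⟨ arith (2 ^ d) ⟩
  2 ^ d * 2 ^ d * 2                                       ≡⟨ ∑-const d 2 ⟨
  ∑ {d} (λ _ → 2)                                         ≡⟨ ∑-cong two ⟨
  ∑ (λ R → dist₄ (sumOver R λ x → multiplicity x Bs))     ≤⟨ ∑-dist₄-multiplicity Bs-proper ⟩
  m * (suc d * 2 ^ d)                                     ≡⟨ *-assoc m (suc d) (2 ^ d) ⟨
  m * suc d * 2 ^ d                                       ∎)
  where
  open ≤-Reasoning
  instance _ = m^n≢0 2 d

  two : ∀ R → dist₄ (sumOver R λ x → multiplicity x Bs) ≡ 2
  two R with k , eq ← sumOver-2 R =
    trans (cong dist₄ (trans (sumOver-cong R covers) eq)) (dist₄-periodic k 2)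

  arith : ∀ p → 2 * p * p ≡ p * p * 2
  arith = solve-∀

theorem3p1 : ∀ (d : ℕ) → (+ f d) / 1 ≥ (+ (2 ^ suc d)) / suc d
-- Between unnormalised fractions the inequality is cross-multiplication, hence `doubleCover-size`.
-- `mkℚᵘ` stores the denominator minus one, so `d` and `0` encode d + 1 and 1.
theorem3p1 d = ℚ.toℚᵘ-cancel-≤
  (ℚᵘ.≤-respˡ-≃ (ℚᵘ.≃-sym (ℚ.toℚᵘ-fromℚᵘ (mkℚᵘ (+ (2 ^ suc d)) d)))
  (ℚᵘ.≤-respʳ-≃ (ℚᵘ.≃-sym (ℚ.toℚᵘ-fromℚᵘ (mkℚᵘ (+ f d) 0)))
  (*≤* (subst₂ ℤ._≤_ (sym (ℤ.*-identityʳ _)) (ℤ.pos-* (f d) (suc d))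
         (ℤ.+≤+ (doubleCover-size (proj₁ (f-isMinimum d))))))))
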